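{- Let $\Gamma$ be a well-formed EPTS context (of a functional PTS specification) and $M$ a Dedukti term in $\beta$-normal form. If $[\![\Gamma]\!]\vdash_{DK}M:\Pi x:A.B$, then $M=\lambda x:A'.N$ for some $A',N$ with $A'\equiv A$ and $[\![\Gamma]\!],x:A\vdash_{DK}N:B$.
   Context: Functional PTS specification $(\mathcal S,\mathcal A,\mathcal R)$ and its EPTS (terms $x\mid s\mid\Pi_{s_1,s_2}(A,x.B)\mid\lambda_{s_1,s_2}(A,x.B,x.M)\mid@_{s_1,s_2}(A,x.B,M,N)$, typing with sorts, products of sort triple in $\mathcal R$, explicit abstraction and application). $\vdash_{DK}$ is Dedukti typing ($\lambda\Pi$-calculus with constants, conversion $\equiv$ modulo $\beta$ and rewrite rules) in the theory $(\Sigma_{EPTS},\mathscr R_{EPTS})$: $\mathbf U_s:\mathtt{TYPE}$, $\mathbf{El}_s[A:\mathbf U_s]:\mathtt{TYPE}$; for $(s_1,s_2)\in\mathcal A$, $\mathbf u_{s_1}:\mathbf U_{s_2}$ and rule $\mathbf{El}_{s_2}\mathbf u_{s_1}\hookrightarrow\mathbf U_{s_1}$; for $(s_1,s_2,s_3)\in\mathcal R$, $\mathbf{Prod}_{s_1,s_2}[A:\mathbf U_{s_1};B:\mathbf{El}_{s_1}A\to\mathbf U_{s_2}]:\mathbf U_{s_3}$, $\mathbf{abs}_{s_1,s_2}[A;B;M:\Pi x:\mathbf{El}_{s_1}A.\mathbf{El}_{s_2}(Bx)]:\mathbf{El}_{s_3}(\mathbf{Prod}_{s_1,s_2}AB)$,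 $\mathbf{app}_{s_1,s_2}[A;B;M:\mathbf{El}_{s_3}(\mathbf{Prod}_{s_1,s_2}AB);N:\mathbf{El}_{s_1}A]:\mathbf{El}_{s_2}(BN)$ and rule $\mathbf{app}_{s_1,s_2}AB(\mathbf{abs}_{s_1,s_2}A'B'M)N\hookrightarrow MN$. Context translation: $[\![-]\!]=-$, $[\![\Gamma,x:A]\!]=[\![\Gamma]\!],x:\mathbf{El}_{s_A}[\![A]\!]$ where $\Gamma\vdash A:s_A$, with $[\![A]\!]$ the term translation ($x\mapsto x$, $s\mapsto\mathbf u_s$, $\Pi_{s_1,s_2}(A,x.B)\mapsto\mathbf{Prod}_{s_1,s_2}[\![A]\!](\lambda x:\mathbf{El}_{s_1}[\![A]\!].[\![B]\!])$, $\lambda_{s_1,s_2}(A,x.B,x.M)\mapsto\mathbf{abs}_{s_1,s_2}[\![A]\!](\lambda x:\mathbf{El}_{s_1}[\![A]\!].[\![B]\!])(\lambda x:\mathbf{El}_{s_1}[\![A]\!].[\![M]\!])$, $@_{s_1,s_2}(A,x.B,M,N)\mapsto\mathbf{app}_{s_1,s_2}[\![A]\!](\lambda x:\mathbf{El}_{s_1}[\![A]\!].[\![B]\!])[\![M]\!][\![N]\!]$). -}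

module Defs where

open import Level using (Level)
open import Data.Nat using (ℕ; zero; suc)
open import Data.Fin using (Fin; zero; suc)
open import Data.Product using (Σ; _×_; _,_)
open import Relation.Binary.PropositionalEquality using (_≡_)
open import Relation.Nullary using (¬_)

record Spec : Set₁ where
  field
    Sort : Set
    Ax   : Sort → Sort → Set
    Rl   : Sort → Sort → Sort → Set
    Ax-functional : ∀ {s s′ s″} → Ax s s′ → Ax s s″ → s′ ≡ s″
    Rl-functional : ∀ {s₁ s₂ s s′} → Rl s₁ s₂ s → Rl s₁ s₂ s′ → s ≡ s′

-- Everything below is relative to a fixed specification.
-- Terms use well-scoped de Bruijn indices: a term in `Tm n` has n free
-- variables; binders (x. _) extend the scope by one.

module Theory (S : Spec) where
  open Spec S

  -- EPTS syntax
  --   x | s | Π_{s1,s2}(A,x.B) | λ_{s1,s2}(A,x.B,x.M) | @_{s1,s2}(A,x.B,M,N)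

  data ETm (n : ℕ) : Set where
    var : Fin n → ETm n
    srt : Sort → ETm n
    Π   : Sort → Sort → ETm n → ETm (suc n) → ETm n
    ƛ   : Sort → Sort → ETm n → ETm (suc n) → ETm (suc n) → ETm n
    ap  : Sort → Sort → ETm n → ETm (suc n) → ETm n → ETm n → ETm n

  ERen : ℕ → ℕ → Set
  ERen m n = Fin m → Fin n

  liftR : ∀ {m n} → ERen m n → ERen (suc m) (suc n)
  liftR ρ zero    = zero
  liftR ρ (suc i) = suc (ρ i)

  eren : ∀ {m n} → ERen m n → ETm m → ETm n
  eren ρ (var i)           = var (ρ i)
  eren ρ (srt s)           = srt s
  eren ρ (Π s₁ s₂ A B)     = Π s₁ s₂ (eren ρ A) (eren (liftR ρ) B)
  eren ρ (ƛ s₁ s₂ A B M)   = ƛ s₁ s₂ (eren ρ A) (eren (liftR ρ) B) (eren (liftR ρ) M)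
  eren ρ (ap s₁ s₂ A B M N) = ap s₁ s₂ (eren ρ A) (eren (liftR ρ) B) (eren ρ M) (eren ρ N)

  eliftS : ∀ {m n} → (Fin m → ETm n) → Fin (suc m) → ETm (suc n)
  eliftS σ zero    = var zero
  eliftS σ (suc i) = eren suc (σ i)

  esub : ∀ {m n} → (Fin m → ETm n) → ETm m → ETm n
  esub σ (var i)           = σ i
  esub σ (srt s)           = srt s
  esub σ (Π s₁ s₂ A B)     = Π s₁ s₂ (esub σ A) (esub (eliftS σ) B)
  esub σ (ƛ s₁ s₂ A B M)   = ƛ s₁ s₂ (esub σ A) (esub (eliftS σ) B) (esub (eliftS σ) M)
  esub σ (ap s₁ s₂ A B M N) = ap s₁ s₂ (esub σ A) (esub (eliftS σ) B) (esub σ M) (esub σ N)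

  esub₀ : ∀ {n} → ETm n → Fin (suc n) → ETm n
  esub₀ N zero    = N
  esub₀ N (suc i) = var i

  _[_]ᴱ : ∀ {n} → ETm (suc n) → ETm n → ETm n
  M [ N ]ᴱ = esub (esub₀ N) M

  data ECtx : ℕ → Set where
    ∅   : ECtx zero
    _▸_ : ∀ {n} → ECtx n → ETm n → ECtx (suc n)

  elookup : ∀ {n} → ECtx n → Fin n → ETm n
  elookup (Γ ▸ A) zero    = eren suc A
  elookup (Γ ▸ A) (suc i) = eren suc (elookup Γ i)

  data ERoot : ∀ {n} → ETm n → ETm n → Set where
    β : ∀ {n s₁ s₂} {A A′ : ETm n} {B B′ M : ETm (suc n)} {N : ETm n} →
        ERoot (ap s₁ s₂ A B (ƛ s₁ s₂ A′ B′ M) N) (M [ N ]ᴱ)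

  data _⟶ᴱ_ : ∀ {n} → ETm n → ETm n → Set where
    root : ∀ {n} {M M′ : ETm n} → ERoot M M′ → M ⟶ᴱ M′
    Π₁ : ∀ {n s₁ s₂} {A A′ : ETm n} {B} → A ⟶ᴱ A′ → Π s₁ s₂ A B ⟶ᴱ Π s₁ s₂ A′ B
    Π₂ : ∀ {n s₁ s₂} {A : ETm n} {B B′} → B ⟶ᴱ B′ → Π s₁ s₂ A B ⟶ᴱ Π s₁ s₂ A B′
    ƛ₁ : ∀ {n s₁ s₂} {A A′ : ETm n} {B M} → A ⟶ᴱ A′ → ƛ s₁ s₂ A B M ⟶ᴱ ƛ s₁ s₂ A′ B M
    ƛ₂ : ∀ {n s₁ s₂} {A : ETm n} {B B′ M} → B ⟶ᴱ B′ → ƛ s₁ s₂ A B M ⟶ᴱ ƛ s₁ s₂ A B′ M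
    ƛ₃ : ∀ {n s₁ s₂} {A : ETm n} {B M M′} → M ⟶ᴱ M′ → ƛ s₁ s₂ A B M ⟶ᴱ ƛ s₁ s₂ A B M′
    ap₁ : ∀ {n s₁ s₂} {A A′ : ETm n} {B M N} → A ⟶ᴱ A′ → ap s₁ s₂ A B M N ⟶ᴱ ap s₁ s₂ A′ B M N
    ap₂ : ∀ {n s₁ s₂} {A : ETm n} {B B′ M N} → B ⟶ᴱ B′ → ap s₁ s₂ A B M N ⟶ᴱ ap s₁ s₂ A B′ M N
    ap₃ : ∀ {n s₁ s₂} {A : ETm n} {B M M′ N} → M ⟶ᴱ M′ → ap s₁ s₂ A B M N ⟶ᴱ ap s₁ s₂ A B M′ N
    ap₄ : ∀ {n s₁ s₂} {A : ETm n} {B M N N′} → N ⟶ᴱ N′ → ap s₁ s₂ A B M N ⟶ᴱ ap s₁ s₂ A B M N′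

  data _≡ᴱ_ {n} : ETm n → ETm n → Set where
    step  : ∀ {M M′} → M ⟶ᴱ M′ → M ≡ᴱ M′
    refl  : ∀ {M} → M ≡ᴱ M
    sym   : ∀ {M M′} → M ≡ᴱ M′ → M′ ≡ᴱ M
    trans : ∀ {M M′ M″} → M ≡ᴱ M′ → M′ ≡ᴱ M″ → M ≡ᴱ M″

  mutual
    data ⊢ᴱ_ : ∀ {n} → ECtx n → Set where
      ∅   : ⊢ᴱ ∅
      _▸_ : ∀ {n} {Γ : ECtx n} {A s} → ⊢ᴱ Γ → Γ ⊢ᴱ A ∶ srt s → ⊢ᴱ (Γ ▸ A)

    data _⊢ᴱ_∶_ {n} (Γ : ECtx n) : ETm n → ETm n → Set where
      sort : ∀ {s₁ s₂} → Ax s₁ s₂ → ⊢ᴱ Γ → Γ ⊢ᴱ srt s₁ ∶ srt s₂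
      var  : ⊢ᴱ Γ → (i : Fin n) → Γ ⊢ᴱ var i ∶ elookup Γ i
      prod : ∀ {s₁ s₂ s₃ A B} → Rl s₁ s₂ s₃ →
             Γ ⊢ᴱ A ∶ srt s₁ → (Γ ▸ A) ⊢ᴱ B ∶ srt s₂ →
             Γ ⊢ᴱ Π s₁ s₂ A B ∶ srt s₃
      abs  : ∀ {s₁ s₂ s₃ A B M} → Rl s₁ s₂ s₃ →
             Γ ⊢ᴱ A ∶ srt s₁ → (Γ ▸ A) ⊢ᴱ B ∶ srt s₂ → (Γ ▸ A) ⊢ᴱ M ∶ B →
             Γ ⊢ᴱ ƛ s₁ s₂ A B M ∶ Π s₁ s₂ A B
      app  : ∀ {s₁ s₂ s₃ A B M N} → Rl s₁ s₂ s₃ →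
             Γ ⊢ᴱ A ∶ srt s₁ → (Γ ▸ A) ⊢ᴱ B ∶ srt s₂ →
             Γ ⊢ᴱ M ∶ Π s₁ s₂ A B → Γ ⊢ᴱ N ∶ A →
             Γ ⊢ᴱ ap s₁ s₂ A B M N ∶ (B [ N ]ᴱ)
      conv : ∀ {M A B s} → Γ ⊢ᴱ M ∶ A → Γ ⊢ᴱ B ∶ srt s → A ≡ᴱ B → Γ ⊢ᴱ M ∶ B

  -- Constants are always
  -- fully applied (c[Δ] : T notation):
  --   U_s, El_s(A), u_s, Prod_{s1,s2}(A,B), abs_{s1,s2}(A,B,M),
  --   app_{s1,s2}(A,B,M,N).

  data DTm (n : ℕ) : Set where
    var  : Fin n → DTm n
    TYPE : DTm n
    KIND : DTm n
    Pi   : DTm n → DTm (suc n) → DTm n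
    Lam  : DTm n → DTm (suc n) → DTm n
    App  : DTm n → DTm n → DTm n
    cU    : Sort → DTm n
    cEl   : Sort → DTm n → DTm n
    cu    : Sort → DTm n
    cProd : Sort → Sort → DTm n → DTm n → DTm n
    cabs  : Sort → Sort → DTm n → DTm n → DTm n → DTm n
    capp  : Sort → Sort → DTm n → DTm n → DTm n → DTm n → DTm n

  dren : ∀ {m n} → ERen m n → DTm m → DTm n
  dren ρ (var i)            = var (ρ i)
  dren ρ TYPE               = TYPE
  dren ρ KIND               = KIND
  dren ρ (Pi A B)           = Pi (dren ρ A) (dren (liftR ρ) B)
  dren ρ (Lam A M)          = Lam (dren ρ A) (dren (liftR ρ) M)
  dren ρ (App M N)          = App (dren ρ M) (dren ρ N)
  dren ρ (cU s)             = cU s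
  dren ρ (cEl s A)          = cEl s (dren ρ A)
  dren ρ (cu s)             = cu s
  dren ρ (cProd s₁ s₂ A B)  = cProd s₁ s₂ (dren ρ A) (dren ρ B)
  dren ρ (cabs s₁ s₂ A B M) = cabs s₁ s₂ (dren ρ A) (dren ρ B) (dren ρ M)
  dren ρ (capp s₁ s₂ A B M N) =
    capp s₁ s₂ (dren ρ A) (dren ρ B) (dren ρ M) (dren ρ N)

  dliftS : ∀ {m n} → (Fin m → DTm n) → Fin (suc m) → DTm (suc n)
  dliftS σ zero    = var zero
  dliftS σ (suc i) = dren suc (σ i)

  dsub : ∀ {m n} → (Fin m → DTm n) → DTm m → DTm n
  dsub σ (var i)            = σ i
  dsub σ TYPE               = TYPE
  dsub σ KIND               = KIND
  dsub σ (Pi A B)           = Pi (dsub σ A) (dsub (dliftS σ) B)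
  dsub σ (Lam A M)          = Lam (dsub σ A) (dsub (dliftS σ) M)
  dsub σ (App M N)          = App (dsub σ M) (dsub σ N)
  dsub σ (cU s)             = cU s
  dsub σ (cEl s A)          = cEl s (dsub σ A)
  dsub σ (cu s)             = cu s
  dsub σ (cProd s₁ s₂ A B)  = cProd s₁ s₂ (dsub σ A) (dsub σ B)
  dsub σ (cabs s₁ s₂ A B M) = cabs s₁ s₂ (dsub σ A) (dsub σ B) (dsub σ M)
  dsub σ (capp s₁ s₂ A B M N) =
    capp s₁ s₂ (dsub σ A) (dsub σ B) (dsub σ M) (dsub σ N)

  dsub₀ : ∀ {n} → DTm n → Fin (suc n) → DTm n
  dsub₀ N zero    = N
  dsub₀ N (suc i) = var i

  _[_]ᴰ : ∀ {n} → DTm (suc n) → DTm n → DTm n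
  M [ N ]ᴰ = dsub (dsub₀ N) M

  data DCtx : ℕ → Set where
    ∅   : DCtx zero
    _▸_ : ∀ {n} → DCtx n → DTm n → DCtx (suc n)

  dlookup : ∀ {n} → DCtx n → Fin n → DTm n
  dlookup (Γ ▸ A) zero    = dren suc A
  dlookup (Γ ▸ A) (suc i) = dren suc (dlookup Γ i)

  data βRoot : ∀ {n} → DTm n → DTm n → Set where
    β : ∀ {n} {A : DTm n} {M N} → βRoot (App (Lam A M) N) (M [ N ]ᴰ)

  data βRRoot : ∀ {n} → DTm n → DTm n → Set where
    β     : ∀ {n} {A : DTm n} {M N} → βRRoot (App (Lam A M) N) (M [ N ]ᴰ)
    El-u  : ∀ {n s₁ s₂} → Ax s₁ s₂ → βRRoot {n} (cEl s₂ (cu s₁)) (cU s₁)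
    app-abs : ∀ {n s₁ s₂ s₃} {A B A′ B′ M N : DTm n} → Rl s₁ s₂ s₃ →
              βRRoot (capp s₁ s₂ A B (cabs s₁ s₂ A′ B′ M) N) (App M N)

  data Comp (R : ∀ {m} → DTm m → DTm m → Set) : ∀ {n} → DTm n → DTm n → Set where
    root : ∀ {n} {M M′ : DTm n} → R M M′ → Comp R M M′
    Pi₁  : ∀ {n} {A A′ : DTm n} {B} → Comp R A A′ → Comp R (Pi A B) (Pi A′ B)
    Pi₂  : ∀ {n} {A : DTm n} {B B′} → Comp R B B′ → Comp R (Pi A B) (Pi A B′)
    Lam₁ : ∀ {n} {A A′ : DTm n} {M} → Comp R A A′ → Comp R (Lam A M) (Lam A′ M)
    Lam₂ : ∀ {n} {A : DTm n} {M M′} → Comp R M M′ → Comp R (Lam A M) (Lam A M′)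
    App₁ : ∀ {n} {M M′ N : DTm n} → Comp R M M′ → Comp R (App M N) (App M′ N)
    App₂ : ∀ {n} {M N N′ : DTm n} → Comp R N N′ → Comp R (App M N) (App M N′)
    El₁  : ∀ {n s} {A A′ : DTm n} → Comp R A A′ → Comp R (cEl s A) (cEl s A′)
    Prod₁ : ∀ {n s₁ s₂} {A A′ B : DTm n} → Comp R A A′ →
            Comp R (cProd s₁ s₂ A B) (cProd s₁ s₂ A′ B)
    Prod₂ : ∀ {n s₁ s₂} {A B B′ : DTm n} → Comp R B B′ →
            Comp R (cProd s₁ s₂ A B) (cProd s₁ s₂ A B′)
    abs₁ : ∀ {n s₁ s₂} {A A′ B M : DTm n} → Comp R A A′ →
           Comp R (cabs s₁ s₂ A B M) (cabs s₁ s₂ A′ B M)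
    abs₂ : ∀ {n s₁ s₂} {A B B′ M : DTm n} → Comp R B B′ →
           Comp R (cabs s₁ s₂ A B M) (cabs s₁ s₂ A B′ M)
    abs₃ : ∀ {n s₁ s₂} {A B M M′ : DTm n} → Comp R M M′ →
           Comp R (cabs s₁ s₂ A B M) (cabs s₁ s₂ A B M′)
    app₁ : ∀ {n s₁ s₂} {A A′ B M N : DTm n} → Comp R A A′ →
           Comp R (capp s₁ s₂ A B M N) (capp s₁ s₂ A′ B M N)
    app₂ : ∀ {n s₁ s₂} {A B B′ M N : DTm n} → Comp R B B′ →
           Comp R (capp s₁ s₂ A B M N) (capp s₁ s₂ A B′ M N)
    app₃ : ∀ {n s₁ s₂} {A B M M′ N : DTm n} → Comp R M M′ →
           Comp R (capp s₁ s₂ A B M N) (capp s₁ s₂ A B M′ N)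
    app₄ : ∀ {n s₁ s₂} {A B M N N′ : DTm n} → Comp R N N′ →
           Comp R (capp s₁ s₂ A B M N) (capp s₁ s₂ A B M N′)

  βNormal : ∀ {n} → DTm n → Set
  βNormal M = ∀ M′ → ¬ Comp βRoot M M′

  data _≡ᴰ_ {n} : DTm n → DTm n → Set where
    step  : ∀ {M M′} → Comp βRRoot M M′ → M ≡ᴰ M′
    refl  : ∀ {M} → M ≡ᴰ M
    sym   : ∀ {M M′} → M ≡ᴰ M′ → M′ ≡ᴰ M
    trans : ∀ {M M′ M″} → M ≡ᴰ M′ → M′ ≡ᴰ M″ → M ≡ᴰ M″

  data DSort : Set where
    type kind : DSort

  ⌜_⌝ : ∀ {n} → DSort → DTm n
  ⌜ type ⌝ = TYPE
  ⌜ kind ⌝ = KIND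

  mutual
    data ⊢ᴰ_ : ∀ {n} → DCtx n → Set where
      ∅   : ⊢ᴰ ∅
      _▸_ : ∀ {n} {Γ : DCtx n} {A s} → ⊢ᴰ Γ → Γ ⊢ᴰ A ∶ ⌜ s ⌝ → ⊢ᴰ (Γ ▸ A)

    data _⊢ᴰ_∶_ {n} (Γ : DCtx n) : DTm n → DTm n → Set where
      var  : ⊢ᴰ Γ → (i : Fin n) → Γ ⊢ᴰ var i ∶ dlookup Γ i
      sort : ⊢ᴰ Γ → Γ ⊢ᴰ TYPE ∶ KIND
      pi   : ∀ {A B s} → Γ ⊢ᴰ A ∶ TYPE → (Γ ▸ A) ⊢ᴰ B ∶ ⌜ s ⌝ → Γ ⊢ᴰ Pi A B ∶ ⌜ s ⌝
      lam  : ∀ {A B M s} → Γ ⊢ᴰ A ∶ TYPE → (Γ ▸ A) ⊢ᴰ B ∶ ⌜ s ⌝ →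
             (Γ ▸ A) ⊢ᴰ M ∶ B → Γ ⊢ᴰ Lam A M ∶ Pi A B
      app  : ∀ {A B M N} → Γ ⊢ᴰ M ∶ Pi A B → Γ ⊢ᴰ N ∶ A → Γ ⊢ᴰ App M N ∶ (B [ N ]ᴰ)
      conv : ∀ {M A B s} → Γ ⊢ᴰ M ∶ A → Γ ⊢ᴰ B ∶ ⌜ s ⌝ → A ≡ᴰ B → Γ ⊢ᴰ M ∶ B
      U    : ∀ {s} → ⊢ᴰ Γ → Γ ⊢ᴰ cU s ∶ TYPE
      El   : ∀ {s A} → Γ ⊢ᴰ A ∶ cU s → Γ ⊢ᴰ cEl s A ∶ TYPE
      u    : ∀ {s₁ s₂} → Ax s₁ s₂ → ⊢ᴰ Γ → Γ ⊢ᴰ cu s₁ ∶ cU s₂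
      Prod : ∀ {s₁ s₂ s₃ A B} → Rl s₁ s₂ s₃ →
             Γ ⊢ᴰ A ∶ cU s₁ → Γ ⊢ᴰ B ∶ Pi (cEl s₁ A) (cU s₂) →
             Γ ⊢ᴰ cProd s₁ s₂ A B ∶ cU s₃
      abs  : ∀ {s₁ s₂ s₃ A B M} → Rl s₁ s₂ s₃ →
             Γ ⊢ᴰ A ∶ cU s₁ → Γ ⊢ᴰ B ∶ Pi (cEl s₁ A) (cU s₂) →
             Γ ⊢ᴰ M ∶ Pi (cEl s₁ A) (cEl s₂ (App (dren suc B) (var zero))) →
             Γ ⊢ᴰ cabs s₁ s₂ A B M ∶ cEl s₃ (cProd s₁ s₂ A B)
      appc : ∀ {s₁ s₂ s₃ A B M N} → Rl s₁ s₂ s₃ →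
             Γ ⊢ᴰ A ∶ cU s₁ → Γ ⊢ᴰ B ∶ Pi (cEl s₁ A) (cU s₂) →
             Γ ⊢ᴰ M ∶ cEl s₃ (cProd s₁ s₂ A B) → Γ ⊢ᴰ N ∶ cEl s₁ A →
             Γ ⊢ᴰ capp s₁ s₂ A B M N ∶ cEl s₂ (App B N)

  ⟦_⟧ : ∀ {n} → ETm n → DTm n
  ⟦ var i ⟧           = var i
  ⟦ srt s ⟧           = cu s
  ⟦ Π s₁ s₂ A B ⟧     = cProd s₁ s₂ ⟦ A ⟧ (Lam (cEl s₁ ⟦ A ⟧) ⟦ B ⟧)
  ⟦ ƛ s₁ s₂ A B M ⟧   = cabs s₁ s₂ ⟦ A ⟧ (Lam (cEl s₁ ⟦ A ⟧) ⟦ B ⟧) (Lam (cEl s₁ ⟦ A ⟧) ⟦ M ⟧)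
  ⟦ ap s₁ s₂ A B M N ⟧ = capp s₁ s₂ ⟦ A ⟧ (Lam (cEl s₁ ⟦ A ⟧) ⟦ B ⟧) ⟦ M ⟧ ⟦ N ⟧

  -- context translation; the sort s_A is the one from the derivation
  -- Γ ⊢ A : s_A witnessing well-formedness (unique, the PTS being functional)
  ⟦_⟧ᶜ : ∀ {n} {Γ : ECtx n} → ⊢ᴱ Γ → DCtx n
  ⟦ ∅ ⟧ᶜ = ∅
  ⟦ _▸_ {A = A} {s = s} wf _ ⟧ᶜ = ⟦ wf ⟧ᶜ ▸ cEl s ⟦ A ⟧

-- A β-normal term is an abstraction, an application, a variable or a fully applied
-- constant.  In the translated context every variable has a type El_s A, and every constant
-- has a type TYPE, KIND, U_s or El_s X; a normal application cannot have a product type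
-- either, since its head would then be an abstraction and the application a redex.  None of
-- these types is convertible to a product: their reducts are again of one of these four
-- shapes, and βR-conversion is confluent because parallel reduction has the diamond property.
-- So M = λx:A′.N, and confluence also makes Π injective, which gives A′ ≡ A and lets N be
-- retyped in the context extended by A.
module Submission where

open import Level using (_⊔_)
open import Data.Nat using (suc; zero)
open import Data.Fin using (Fin; zero; suc)
open import Data.Product using (Σ; ∃; ∃₂; _×_; _,_)
open import Data.Empty using (⊥-elim)
open import Function using (id; _∘_)
open import Relation.Nullary using (¬_)
open import Relation.Binary.Core using (Rel)
open import Relation.Binary.Construct.Closure.ReflexiveTransitive using (Star; ε; _◅_; _◅◅_; fold)
open import Relation.Binary.Rewriting using (Confluent)
open import Relation.Binary.PropositionalEquality using (_≡_; refl; subst; cong; cong₂)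
import Relation.Binary.PropositionalEquality as ≡
open import Defs

Diamond : ∀ {a ℓ} {A : Set a} → Rel A ℓ → Set (a ⊔ ℓ)
Diamond _⟶_ = ∀ {x y z} → x ⟶ y → x ⟶ z → ∃ λ w → (y ⟶ w) × (z ⟶ w)

module _ {a ℓ} {A : Set a} {_⟶_ : Rel A ℓ} where

  diamond-strip : Diamond _⟶_ → ∀ {x y z} → x ⟶ y → Star _⟶_ x z →
                  ∃ λ w → Star _⟶_ y w × (z ⟶ w)
  diamond-strip diamond p ε = _ , ε , p
  diamond-strip diamond p (q ◅ qs) with diamond p q
  ... | _ , p′ , q′ with diamond-strip diamond q′ qs
  ...   | _ , r , s = _ , p′ ◅ r , s

  diamond⇒confluent : Diamond _⟶_ → Confluent _⟶_
  diamond⇒confluent diamond ε q = _ , q , ε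
  diamond⇒confluent diamond (p ◅ ps) q with diamond-strip diamond p q
  ... | _ , r , s with diamond⇒confluent diamond ps r
  ...   | _ , a , b = _ , a , s ◅ b

module Metatheory (S : Spec) where
  open Spec S using (Ax; Rl)
  open Theory S

  private
    cong₃ : ∀ {A B C D : Set} (f : A → B → C → D) {a a′ b b′ c c′} →
            a ≡ a′ → b ≡ b′ → c ≡ c′ → f a b c ≡ f a′ b′ c′
    cong₃ f refl refl refl = refl

    cong₄ : ∀ {A B C D E : Set} (f : A → B → C → D → E) {a a′ b b′ c c′ d d′} →
            a ≡ a′ → b ≡ b′ → c ≡ c′ → d ≡ d′ → f a b c d ≡ f a′ b′ c′ d′
    cong₄ f refl refl refl refl = refl

  -- Renaming and substitution

  liftR-∘ : ∀ {l m n} {ρ : ERen m n} {ρ′ : ERen l m} {ρ″ : ERen l n} →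
            (∀ i → ρ (ρ′ i) ≡ ρ″ i) → ∀ i → liftR ρ (liftR ρ′ i) ≡ liftR ρ″ i
  liftR-∘ e zero = refl
  liftR-∘ e (suc i) = cong suc (e i)

  dren-dren : ∀ {l m n} {ρ : ERen m n} {ρ′ : ERen l m} {ρ″ : ERen l n} →
              (∀ i → ρ (ρ′ i) ≡ ρ″ i) → ∀ M → dren ρ (dren ρ′ M) ≡ dren ρ″ M
  dren-dren e (var i) = cong var (e i)
  dren-dren e TYPE = refl
  dren-dren e KIND = refl
  dren-dren e (Pi A B) = cong₂ Pi (dren-dren e A) (dren-dren (liftR-∘ e) B)
  dren-dren e (Lam A M) = cong₂ Lam (dren-dren e A) (dren-dren (liftR-∘ e) M)
  dren-dren e (App M N) = cong₂ App (dren-dren e M) (dren-dren e N)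
  dren-dren e (cU s) = refl
  dren-dren e (cEl s A) = cong (cEl s) (dren-dren e A)
  dren-dren e (cu s) = refl
  dren-dren e (cProd s₁ s₂ A B) = cong₂ (cProd s₁ s₂) (dren-dren e A) (dren-dren e B)
  dren-dren e (cabs s₁ s₂ A B M) =
    cong₃ (cabs s₁ s₂) (dren-dren e A) (dren-dren e B) (dren-dren e M)
  dren-dren e (capp s₁ s₂ A B M N) =
    cong₄ (capp s₁ s₂) (dren-dren e A) (dren-dren e B) (dren-dren e M) (dren-dren e N)

  dren-liftR-suc : ∀ {m n} (ρ : ERen m n) M → dren (liftR ρ) (dren suc M) ≡ dren suc (dren ρ M)
  dren-liftR-suc ρ M = ≡.trans (dren-dren (λ _ → refl) M) (≡.sym (dren-dren (λ _ → refl) M))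

  dliftS-liftR : ∀ {l m n} {σ : Fin m → DTm n} {ρ : ERen l m} {τ : Fin l → DTm n} →
                 (∀ i → σ (ρ i) ≡ τ i) → ∀ i → dliftS σ (liftR ρ i) ≡ dliftS τ i
  dliftS-liftR e zero = refl
  dliftS-liftR e (suc i) = cong (dren suc) (e i)

  dsub-dren : ∀ {l m n} {σ : Fin m → DTm n} {ρ : ERen l m} {τ : Fin l → DTm n} →
              (∀ i → σ (ρ i) ≡ τ i) → ∀ M → dsub σ (dren ρ M) ≡ dsub τ M
  dsub-dren e (var i) = e i
  dsub-dren e TYPE = refl
  dsub-dren e KIND = refl
  dsub-dren e (Pi A B) = cong₂ Pi (dsub-dren e A) (dsub-dren (dliftS-liftR e) B)
  dsub-dren e (Lam A M) = cong₂ Lam (dsub-dren e A) (dsub-dren (dliftS-liftR e) M)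
  dsub-dren e (App M N) = cong₂ App (dsub-dren e M) (dsub-dren e N)
  dsub-dren e (cU s) = refl
  dsub-dren e (cEl s A) = cong (cEl s) (dsub-dren e A)
  dsub-dren e (cu s) = refl
  dsub-dren e (cProd s₁ s₂ A B) = cong₂ (cProd s₁ s₂) (dsub-dren e A) (dsub-dren e B)
  dsub-dren e (cabs s₁ s₂ A B M) =
    cong₃ (cabs s₁ s₂) (dsub-dren e A) (dsub-dren e B) (dsub-dren e M)
  dsub-dren e (capp s₁ s₂ A B M N) =
    cong₄ (capp s₁ s₂) (dsub-dren e A) (dsub-dren e B) (dsub-dren e M) (dsub-dren e N)

  dren-dliftS : ∀ {l m n} {ρ : ERen m n} {σ : Fin l → DTm m} {τ : Fin l → DTm n} →
                (∀ i → dren ρ (σ i) ≡ τ i) → ∀ i → dren (liftR ρ) (dliftS σ i) ≡ dliftS τ i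
  dren-dliftS e zero = refl
  dren-dliftS {ρ = ρ} {σ} e (suc i) = ≡.trans (dren-liftR-suc ρ (σ i)) (cong (dren suc) (e i))

  dren-dsub : ∀ {l m n} {ρ : ERen m n} {σ : Fin l → DTm m} {τ : Fin l → DTm n} →
              (∀ i → dren ρ (σ i) ≡ τ i) → ∀ M → dren ρ (dsub σ M) ≡ dsub τ M
  dren-dsub e (var i) = e i
  dren-dsub e TYPE = refl
  dren-dsub e KIND = refl
  dren-dsub e (Pi A B) = cong₂ Pi (dren-dsub e A) (dren-dsub (dren-dliftS e) B)
  dren-dsub e (Lam A M) = cong₂ Lam (dren-dsub e A) (dren-dsub (dren-dliftS e) M)
  dren-dsub e (App M N) = cong₂ App (dren-dsub e M) (dren-dsub e N)
  dren-dsub e (cU s) = refl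
  dren-dsub e (cEl s A) = cong (cEl s) (dren-dsub e A)
  dren-dsub e (cu s) = refl
  dren-dsub e (cProd s₁ s₂ A B) = cong₂ (cProd s₁ s₂) (dren-dsub e A) (dren-dsub e B)
  dren-dsub e (cabs s₁ s₂ A B M) =
    cong₃ (cabs s₁ s₂) (dren-dsub e A) (dren-dsub e B) (dren-dsub e M)
  dren-dsub e (capp s₁ s₂ A B M N) =
    cong₄ (capp s₁ s₂) (dren-dsub e A) (dren-dsub e B) (dren-dsub e M) (dren-dsub e N)

  dsub-dliftS : ∀ {l m n} {σ : Fin m → DTm n} {τ : Fin l → DTm m} {υ : Fin l → DTm n} →
                (∀ i → dsub σ (τ i) ≡ υ i) → ∀ i → dsub (dliftS σ) (dliftS τ i) ≡ dliftS υ i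
  dsub-dliftS e zero = refl
  dsub-dliftS {σ = σ} {τ} {υ} e (suc i) = begin
    dsub (dliftS σ) (dren suc (τ i)) ≡⟨ dsub-dren (λ _ → refl) (τ i) ⟩
    dsub (dren suc ∘ σ) (τ i)        ≡⟨ dren-dsub (λ _ → refl) (τ i) ⟨
    dren suc (dsub σ (τ i))          ≡⟨ cong (dren suc) (e i) ⟩
    dren suc (υ i)                   ∎
    where open ≡.≡-Reasoning

  dsub-dsub : ∀ {l m n} {σ : Fin m → DTm n} {τ : Fin l → DTm m} {υ : Fin l → DTm n} →
              (∀ i → dsub σ (τ i) ≡ υ i) → ∀ M → dsub σ (dsub τ M) ≡ dsub υ M
  dsub-dsub e (var i) = e i
  dsub-dsub e TYPE = refl
  dsub-dsub e KIND = refl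
  dsub-dsub e (Pi A B) = cong₂ Pi (dsub-dsub e A) (dsub-dsub (dsub-dliftS e) B)
  dsub-dsub e (Lam A M) = cong₂ Lam (dsub-dsub e A) (dsub-dsub (dsub-dliftS e) M)
  dsub-dsub e (App M N) = cong₂ App (dsub-dsub e M) (dsub-dsub e N)
  dsub-dsub e (cU s) = refl
  dsub-dsub e (cEl s A) = cong (cEl s) (dsub-dsub e A)
  dsub-dsub e (cu s) = refl
  dsub-dsub e (cProd s₁ s₂ A B) = cong₂ (cProd s₁ s₂) (dsub-dsub e A) (dsub-dsub e B)
  dsub-dsub e (cabs s₁ s₂ A B M) =
    cong₃ (cabs s₁ s₂) (dsub-dsub e A) (dsub-dsub e B) (dsub-dsub e M)
  dsub-dsub e (capp s₁ s₂ A B M N) =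
    cong₄ (capp s₁ s₂) (dsub-dsub e A) (dsub-dsub e B) (dsub-dsub e M) (dsub-dsub e N)

  dliftS-var : ∀ {n} {σ : Fin n → DTm n} → (∀ i → σ i ≡ var i) → ∀ i → dliftS σ i ≡ var i
  dliftS-var e zero = refl
  dliftS-var e (suc i) = cong (dren suc) (e i)

  dsub-var : ∀ {n} {σ : Fin n → DTm n} → (∀ i → σ i ≡ var i) → ∀ M → dsub σ M ≡ M
  dsub-var e (var i) = e i
  dsub-var e TYPE = refl
  dsub-var e KIND = refl
  dsub-var e (Pi A B) = cong₂ Pi (dsub-var e A) (dsub-var (dliftS-var e) B)
  dsub-var e (Lam A M) = cong₂ Lam (dsub-var e A) (dsub-var (dliftS-var e) M)
  dsub-var e (App M N) = cong₂ App (dsub-var e M) (dsub-var e N)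
  dsub-var e (cU s) = refl
  dsub-var e (cEl s A) = cong (cEl s) (dsub-var e A)
  dsub-var e (cu s) = refl
  dsub-var e (cProd s₁ s₂ A B) = cong₂ (cProd s₁ s₂) (dsub-var e A) (dsub-var e B)
  dsub-var e (cabs s₁ s₂ A B M) =
    cong₃ (cabs s₁ s₂) (dsub-var e A) (dsub-var e B) (dsub-var e M)
  dsub-var e (capp s₁ s₂ A B M N) =
    cong₄ (capp s₁ s₂) (dsub-var e A) (dsub-var e B) (dsub-var e M) (dsub-var e N)

  dren-[] : ∀ {m n} (ρ : ERen m n) M N → dren ρ (M [ N ]ᴰ) ≡ dren (liftR ρ) M [ dren ρ N ]ᴰ
  dren-[] ρ M N = ≡.trans (dren-dsub (λ _ → refl) M) (≡.sym (dsub-dren commute M))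
    where
    commute : ∀ i → dsub₀ (dren ρ N) (liftR ρ i) ≡ dren ρ (dsub₀ N i)
    commute zero = refl
    commute (suc i) = refl

  dsub-[] : ∀ {m n} (σ : Fin m → DTm n) M N → dsub σ (M [ N ]ᴰ) ≡ dsub (dliftS σ) M [ dsub σ N ]ᴰ
  dsub-[] σ M N = ≡.trans (dsub-dsub (λ _ → refl) M) (≡.sym (dsub-dsub commute M))
    where
    commute : ∀ i → dsub (dsub₀ (dsub σ N)) (dliftS σ i) ≡ dsub σ (dsub₀ N i)
    commute zero = refl
    commute (suc i) = ≡.trans (dsub-dren (λ _ → refl) (σ i)) (dsub-var (λ _ → refl) (σ i))

  -- Conversion and confluence

  Comp-dren : ∀ {m n} (ρ : ERen m n) {M M′ : DTm m} →
              Comp βRRoot M M′ → Comp βRRoot (dren ρ M) (dren ρ M′)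
  Comp-dren ρ (root (β {M = M} {N})) = subst (Comp βRRoot _) (≡.sym (dren-[] ρ M N)) (root β)
  Comp-dren ρ (root (El-u a)) = root (El-u a)
  Comp-dren ρ (root (app-abs r)) = root (app-abs r)
  Comp-dren ρ (Pi₁ c) = Pi₁ (Comp-dren ρ c)
  Comp-dren ρ (Pi₂ c) = Pi₂ (Comp-dren (liftR ρ) c)
  Comp-dren ρ (Lam₁ c) = Lam₁ (Comp-dren ρ c)
  Comp-dren ρ (Lam₂ c) = Lam₂ (Comp-dren (liftR ρ) c)
  Comp-dren ρ (App₁ c) = App₁ (Comp-dren ρ c)
  Comp-dren ρ (App₂ c) = App₂ (Comp-dren ρ c)
  Comp-dren ρ (El₁ c) = El₁ (Comp-dren ρ c)
  Comp-dren ρ (Prod₁ c) = Prod₁ (Comp-dren ρ c)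
  Comp-dren ρ (Prod₂ c) = Prod₂ (Comp-dren ρ c)
  Comp-dren ρ (abs₁ c) = abs₁ (Comp-dren ρ c)
  Comp-dren ρ (abs₂ c) = abs₂ (Comp-dren ρ c)
  Comp-dren ρ (abs₃ c) = abs₃ (Comp-dren ρ c)
  Comp-dren ρ (app₁ c) = app₁ (Comp-dren ρ c)
  Comp-dren ρ (app₂ c) = app₂ (Comp-dren ρ c)
  Comp-dren ρ (app₃ c) = app₃ (Comp-dren ρ c)
  Comp-dren ρ (app₄ c) = app₄ (Comp-dren ρ c)

  ≡ᴰ-dren : ∀ {m n} (ρ : ERen m n) {M M′ : DTm m} → M ≡ᴰ M′ → dren ρ M ≡ᴰ dren ρ M′
  ≡ᴰ-dren ρ (step c) = step (Comp-dren ρ c)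
  ≡ᴰ-dren ρ refl = refl
  ≡ᴰ-dren ρ (sym e) = sym (≡ᴰ-dren ρ e)
  ≡ᴰ-dren ρ (trans e e′) = trans (≡ᴰ-dren ρ e) (≡ᴰ-dren ρ e′)

  ≡ᴰ-cong : ∀ {m n} (f : DTm m → DTm n) →
            (∀ {x y} → Comp βRRoot x y → Comp βRRoot (f x) (f y)) →
            ∀ {x y} → x ≡ᴰ y → f x ≡ᴰ f y
  ≡ᴰ-cong f f-comp (step c) = step (f-comp c)
  ≡ᴰ-cong f f-comp refl = refl
  ≡ᴰ-cong f f-comp (sym e) = sym (≡ᴰ-cong f f-comp e)
  ≡ᴰ-cong f f-comp (trans e e′) = trans (≡ᴰ-cong f f-comp e) (≡ᴰ-cong f f-comp e′)

  ≡ᴰ-cong₂ : ∀ {k m n} (f : DTm k → DTm m → DTm n) →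
             (∀ {x x′ y} → Comp βRRoot x x′ → Comp βRRoot (f x y) (f x′ y)) →
             (∀ {x y y′} → Comp βRRoot y y′ → Comp βRRoot (f x y) (f x y′)) →
             ∀ {x x′ y y′} → x ≡ᴰ x′ → y ≡ᴰ y′ → f x y ≡ᴰ f x′ y′
  ≡ᴰ-cong₂ f f-comp₁ f-comp₂ {x′ = x′} {y = y} ex ey =
    trans (≡ᴰ-cong (λ x → f x y) f-comp₁ ex) (≡ᴰ-cong (f x′) f-comp₂ ey)

  infix 4 _⇒_ _⇒*_

  data _⇒_ : ∀ {n} → DTm n → DTm n → Set where
    pVar  : ∀ {n} {i : Fin n} → var i ⇒ var i
    pType : ∀ {n} → TYPE {n} ⇒ TYPE
    pKind : ∀ {n} → KIND {n} ⇒ KIND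
    pPi   : ∀ {n} {A A′ : DTm n} {B B′} → A ⇒ A′ → B ⇒ B′ → Pi A B ⇒ Pi A′ B′
    pLam  : ∀ {n} {A A′ : DTm n} {M M′} → A ⇒ A′ → M ⇒ M′ → Lam A M ⇒ Lam A′ M′
    pApp  : ∀ {n} {M M′ N N′ : DTm n} → M ⇒ M′ → N ⇒ N′ → App M N ⇒ App M′ N′
    pU    : ∀ {n s} → cU {n} s ⇒ cU s
    pEl   : ∀ {n s} {A A′ : DTm n} → A ⇒ A′ → cEl s A ⇒ cEl s A′
    pu    : ∀ {n s} → cu {n} s ⇒ cu s
    pProd : ∀ {n s₁ s₂} {A A′ B B′ : DTm n} → A ⇒ A′ → B ⇒ B′ →
            cProd s₁ s₂ A B ⇒ cProd s₁ s₂ A′ B′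
    pAbs  : ∀ {n s₁ s₂} {A A′ B B′ M M′ : DTm n} → A ⇒ A′ → B ⇒ B′ → M ⇒ M′ →
            cabs s₁ s₂ A B M ⇒ cabs s₁ s₂ A′ B′ M′
    pAppc : ∀ {n s₁ s₂} {A A′ B B′ M M′ N N′ : DTm n} →
            A ⇒ A′ → B ⇒ B′ → M ⇒ M′ → N ⇒ N′ →
            capp s₁ s₂ A B M N ⇒ capp s₁ s₂ A′ B′ M′ N′
    pβ    : ∀ {n} {A : DTm n} {M M′ N N′} → M ⇒ M′ → N ⇒ N′ → App (Lam A M) N ⇒ M′ [ N′ ]ᴰ
    pEl-u : ∀ {n s₁ s₂} → Ax s₁ s₂ → cEl {n} s₂ (cu s₁) ⇒ cU s₁
    pApp-abs : ∀ {n s₁ s₂ s₃} {A B A′ B′ M M′ N N′ : DTm n} →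
               Rl s₁ s₂ s₃ → M ⇒ M′ → N ⇒ N′ →
               capp s₁ s₂ A B (cabs s₁ s₂ A′ B′ M) N ⇒ App M′ N′

  _⇒*_ : ∀ {n} → DTm n → DTm n → Set
  _⇒*_ = Star _⇒_

  ⇒-refl : ∀ {n} (M : DTm n) → M ⇒ M
  ⇒-refl (var i) = pVar
  ⇒-refl TYPE = pType
  ⇒-refl KIND = pKind
  ⇒-refl (Pi A B) = pPi (⇒-refl A) (⇒-refl B)
  ⇒-refl (Lam A M) = pLam (⇒-refl A) (⇒-refl M)
  ⇒-refl (App M N) = pApp (⇒-refl M) (⇒-refl N)
  ⇒-refl (cU s) = pU
  ⇒-refl (cEl s A) = pEl (⇒-refl A)
  ⇒-refl (cu s) = pu
  ⇒-refl (cProd s₁ s₂ A B) = pProd (⇒-refl A) (⇒-refl B)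
  ⇒-refl (cabs s₁ s₂ A B M) = pAbs (⇒-refl A) (⇒-refl B) (⇒-refl M)
  ⇒-refl (capp s₁ s₂ A B M N) = pAppc (⇒-refl A) (⇒-refl B) (⇒-refl M) (⇒-refl N)

  ⇒-dren : ∀ {m n} (ρ : ERen m n) {M M′ : DTm m} → M ⇒ M′ → dren ρ M ⇒ dren ρ M′
  ⇒-dren ρ pVar = pVar
  ⇒-dren ρ pType = pType
  ⇒-dren ρ pKind = pKind
  ⇒-dren ρ (pPi a b) = pPi (⇒-dren ρ a) (⇒-dren (liftR ρ) b)
  ⇒-dren ρ (pLam a m) = pLam (⇒-dren ρ a) (⇒-dren (liftR ρ) m)
  ⇒-dren ρ (pApp m n) = pApp (⇒-dren ρ m) (⇒-dren ρ n)
  ⇒-dren ρ pU = pU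
  ⇒-dren ρ (pEl a) = pEl (⇒-dren ρ a)
  ⇒-dren ρ pu = pu
  ⇒-dren ρ (pProd a b) = pProd (⇒-dren ρ a) (⇒-dren ρ b)
  ⇒-dren ρ (pAbs a b m) = pAbs (⇒-dren ρ a) (⇒-dren ρ b) (⇒-dren ρ m)
  ⇒-dren ρ (pAppc a b m n) = pAppc (⇒-dren ρ a) (⇒-dren ρ b) (⇒-dren ρ m) (⇒-dren ρ n)
  ⇒-dren ρ (pβ {M′ = M′} {N′ = N′} m n) =
    subst (_ ⇒_) (≡.sym (dren-[] ρ M′ N′)) (pβ (⇒-dren (liftR ρ) m) (⇒-dren ρ n))
  ⇒-dren ρ (pEl-u a) = pEl-u a
  ⇒-dren ρ (pApp-abs r m n) = pApp-abs r (⇒-dren ρ m) (⇒-dren ρ n)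

  dliftS-⇒ : ∀ {m n} {σ σ′ : Fin m → DTm n} → (∀ i → σ i ⇒ σ′ i) → ∀ i → dliftS σ i ⇒ dliftS σ′ i
  dliftS-⇒ σ⇒σ′ zero = pVar
  dliftS-⇒ σ⇒σ′ (suc i) = ⇒-dren suc (σ⇒σ′ i)

  ⇒-dsub : ∀ {m n} {σ σ′ : Fin m → DTm n} → (∀ i → σ i ⇒ σ′ i) →
           ∀ {M M′} → M ⇒ M′ → dsub σ M ⇒ dsub σ′ M′
  ⇒-dsub σ⇒σ′ (pVar {i = i}) = σ⇒σ′ i
  ⇒-dsub σ⇒σ′ pType = pType
  ⇒-dsub σ⇒σ′ pKind = pKind
  ⇒-dsub σ⇒σ′ (pPi a b) = pPi (⇒-dsub σ⇒σ′ a) (⇒-dsub (dliftS-⇒ σ⇒σ′) b)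
  ⇒-dsub σ⇒σ′ (pLam a m) = pLam (⇒-dsub σ⇒σ′ a) (⇒-dsub (dliftS-⇒ σ⇒σ′) m)
  ⇒-dsub σ⇒σ′ (pApp m n) = pApp (⇒-dsub σ⇒σ′ m) (⇒-dsub σ⇒σ′ n)
  ⇒-dsub σ⇒σ′ pU = pU
  ⇒-dsub σ⇒σ′ (pEl a) = pEl (⇒-dsub σ⇒σ′ a)
  ⇒-dsub σ⇒σ′ pu = pu
  ⇒-dsub σ⇒σ′ (pProd a b) = pProd (⇒-dsub σ⇒σ′ a) (⇒-dsub σ⇒σ′ b)
  ⇒-dsub σ⇒σ′ (pAbs a b m) = pAbs (⇒-dsub σ⇒σ′ a) (⇒-dsub σ⇒σ′ b) (⇒-dsub σ⇒σ′ m)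
  ⇒-dsub σ⇒σ′ (pAppc a b m n) =
    pAppc (⇒-dsub σ⇒σ′ a) (⇒-dsub σ⇒σ′ b) (⇒-dsub σ⇒σ′ m) (⇒-dsub σ⇒σ′ n)
  ⇒-dsub {σ′ = σ′} σ⇒σ′ (pβ {M′ = M′} {N′ = N′} m n) =
    subst (_ ⇒_) (≡.sym (dsub-[] σ′ M′ N′)) (pβ (⇒-dsub (dliftS-⇒ σ⇒σ′) m) (⇒-dsub σ⇒σ′ n))
  ⇒-dsub σ⇒σ′ (pEl-u a) = pEl-u a
  ⇒-dsub σ⇒σ′ (pApp-abs r m n) = pApp-abs r (⇒-dsub σ⇒σ′ m) (⇒-dsub σ⇒σ′ n)

  ⇒-[] : ∀ {n} {M M′ : DTm (suc n)} {N N′} → M ⇒ M′ → N ⇒ N′ → M [ N ]ᴰ ⇒ M′ [ N′ ]ᴰ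
  ⇒-[] m n = ⇒-dsub dsub₀-⇒ m
    where
    dsub₀-⇒ : ∀ i → dsub₀ _ i ⇒ dsub₀ _ i
    dsub₀-⇒ zero = n
    dsub₀-⇒ (suc i) = pVar

  ⇒-diamond : ∀ {n} → Diamond (_⇒_ {n})
  ⇒-diamond pVar pVar = _ , pVar , pVar
  ⇒-diamond pType pType = _ , pType , pType
  ⇒-diamond pKind pKind = _ , pKind , pKind
  ⇒-diamond (pPi a b) (pPi a′ b′) with ⇒-diamond a a′ | ⇒-diamond b b′
  ... | _ , a₁ , a₂ | _ , b₁ , b₂ = _ , pPi a₁ b₁ , pPi a₂ b₂
  ⇒-diamond (pLam a m) (pLam a′ m′) with ⇒-diamond a a′ | ⇒-diamond m m′
  ... | _ , a₁ , a₂ | _ , m₁ , m₂ = _ , pLam a₁ m₁ , pLam a₂ m₂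
  ⇒-diamond (pApp m n) (pApp m′ n′) with ⇒-diamond m m′ | ⇒-diamond n n′
  ... | _ , m₁ , m₂ | _ , n₁ , n₂ = _ , pApp m₁ n₁ , pApp m₂ n₂
  ⇒-diamond (pApp (pLam a m) n) (pβ m′ n′) with ⇒-diamond m m′ | ⇒-diamond n n′
  ... | _ , m₁ , m₂ | _ , n₁ , n₂ = _ , pβ m₁ n₁ , ⇒-[] m₂ n₂
  ⇒-diamond (pβ m n) (pApp (pLam a′ m′) n′) with ⇒-diamond m m′ | ⇒-diamond n n′
  ... | _ , m₁ , m₂ | _ , n₁ , n₂ = _ , ⇒-[] m₁ n₁ , pβ m₂ n₂
  ⇒-diamond (pβ m n) (pβ m′ n′) with ⇒-diamond m m′ | ⇒-diamond n n′
  ... | _ , m₁ , m₂ | _ , n₁ , n₂ = _ , ⇒-[] m₁ n₁ , ⇒-[] m₂ n₂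
  ⇒-diamond pU pU = _ , pU , pU
  ⇒-diamond (pEl a) (pEl a′) with ⇒-diamond a a′
  ... | _ , a₁ , a₂ = _ , pEl a₁ , pEl a₂
  ⇒-diamond (pEl pu) (pEl-u x) = _ , pEl-u x , pU
  ⇒-diamond (pEl-u x) (pEl pu) = _ , pU , pEl-u x
  ⇒-diamond (pEl-u x) (pEl-u y) = _ , pU , pU
  ⇒-diamond pu pu = _ , pu , pu
  ⇒-diamond (pProd a b) (pProd a′ b′) with ⇒-diamond a a′ | ⇒-diamond b b′
  ... | _ , a₁ , a₂ | _ , b₁ , b₂ = _ , pProd a₁ b₁ , pProd a₂ b₂
  ⇒-diamond (pAbs a b m) (pAbs a′ b′ m′)
    with ⇒-diamond a a′ | ⇒-diamond b b′ | ⇒-diamond m m′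
  ... | _ , a₁ , a₂ | _ , b₁ , b₂ | _ , m₁ , m₂ = _ , pAbs a₁ b₁ m₁ , pAbs a₂ b₂ m₂
  ⇒-diamond (pAppc a b m n) (pAppc a′ b′ m′ n′)
    with ⇒-diamond a a′ | ⇒-diamond b b′ | ⇒-diamond m m′ | ⇒-diamond n n′
  ... | _ , a₁ , a₂ | _ , b₁ , b₂ | _ , m₁ , m₂ | _ , n₁ , n₂ =
    _ , pAppc a₁ b₁ m₁ n₁ , pAppc a₂ b₂ m₂ n₂
  ⇒-diamond (pAppc a b (pAbs a′ b′ m) n) (pApp-abs r m′ n′)
    with ⇒-diamond m m′ | ⇒-diamond n n′
  ... | _ , m₁ , m₂ | _ , n₁ , n₂ = _ , pApp-abs r m₁ n₁ , pApp m₂ n₂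
  ⇒-diamond (pApp-abs r m n) (pAppc a′ b′ (pAbs a″ b″ m′) n′)
    with ⇒-diamond m m′ | ⇒-diamond n n′
  ... | _ , m₁ , m₂ | _ , n₁ , n₂ = _ , pApp m₁ n₁ , pApp-abs r m₂ n₂
  ⇒-diamond (pApp-abs r m n) (pApp-abs r′ m′ n′) with ⇒-diamond m m′ | ⇒-diamond n n′
  ... | _ , m₁ , m₂ | _ , n₁ , n₂ = _ , pApp m₁ n₁ , pApp m₂ n₂

  ⇒-confluent : ∀ {n} → Confluent (_⇒_ {n})
  ⇒-confluent = diamond⇒confluent ⇒-diamond

  Comp⊆⇒ : ∀ {n} {M M′ : DTm n} → Comp βRRoot M M′ → M ⇒ M′
  Comp⊆⇒ (root β) = pβ (⇒-refl _) (⇒-refl _)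
  Comp⊆⇒ (root (El-u a)) = pEl-u a
  Comp⊆⇒ (root (app-abs r)) = pApp-abs r (⇒-refl _) (⇒-refl _)
  Comp⊆⇒ (Pi₁ c) = pPi (Comp⊆⇒ c) (⇒-refl _)
  Comp⊆⇒ (Pi₂ c) = pPi (⇒-refl _) (Comp⊆⇒ c)
  Comp⊆⇒ (Lam₁ c) = pLam (Comp⊆⇒ c) (⇒-refl _)
  Comp⊆⇒ (Lam₂ c) = pLam (⇒-refl _) (Comp⊆⇒ c)
  Comp⊆⇒ (App₁ c) = pApp (Comp⊆⇒ c) (⇒-refl _)
  Comp⊆⇒ (App₂ c) = pApp (⇒-refl _) (Comp⊆⇒ c)
  Comp⊆⇒ (El₁ c) = pEl (Comp⊆⇒ c)
  Comp⊆⇒ (Prod₁ c) = pProd (Comp⊆⇒ c) (⇒-refl _)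
  Comp⊆⇒ (Prod₂ c) = pProd (⇒-refl _) (Comp⊆⇒ c)
  Comp⊆⇒ (abs₁ c) = pAbs (Comp⊆⇒ c) (⇒-refl _) (⇒-refl _)
  Comp⊆⇒ (abs₂ c) = pAbs (⇒-refl _) (Comp⊆⇒ c) (⇒-refl _)
  Comp⊆⇒ (abs₃ c) = pAbs (⇒-refl _) (⇒-refl _) (Comp⊆⇒ c)
  Comp⊆⇒ (app₁ c) = pAppc (Comp⊆⇒ c) (⇒-refl _) (⇒-refl _) (⇒-refl _)
  Comp⊆⇒ (app₂ c) = pAppc (⇒-refl _) (Comp⊆⇒ c) (⇒-refl _) (⇒-refl _)
  Comp⊆⇒ (app₃ c) = pAppc (⇒-refl _) (⇒-refl _) (Comp⊆⇒ c) (⇒-refl _)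
  Comp⊆⇒ (app₄ c) = pAppc (⇒-refl _) (⇒-refl _) (⇒-refl _) (Comp⊆⇒ c)

  ⇒⊆≡ᴰ : ∀ {n} {M M′ : DTm n} → M ⇒ M′ → M ≡ᴰ M′
  ⇒⊆≡ᴰ pVar = refl
  ⇒⊆≡ᴰ pType = refl
  ⇒⊆≡ᴰ pKind = refl
  ⇒⊆≡ᴰ (pPi a b) = ≡ᴰ-cong₂ Pi Pi₁ Pi₂ (⇒⊆≡ᴰ a) (⇒⊆≡ᴰ b)
  ⇒⊆≡ᴰ (pLam a m) = ≡ᴰ-cong₂ Lam Lam₁ Lam₂ (⇒⊆≡ᴰ a) (⇒⊆≡ᴰ m)
  ⇒⊆≡ᴰ (pApp m n) = ≡ᴰ-cong₂ App App₁ App₂ (⇒⊆≡ᴰ m) (⇒⊆≡ᴰ n)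
  ⇒⊆≡ᴰ pU = refl
  ⇒⊆≡ᴰ (pEl {s = s} a) = ≡ᴰ-cong (cEl s) El₁ (⇒⊆≡ᴰ a)
  ⇒⊆≡ᴰ pu = refl
  ⇒⊆≡ᴰ (pProd {s₁ = s₁} {s₂} a b) = ≡ᴰ-cong₂ (cProd s₁ s₂) Prod₁ Prod₂ (⇒⊆≡ᴰ a) (⇒⊆≡ᴰ b)
  ⇒⊆≡ᴰ (pAbs {s₁ = s₁} {s₂} {A′ = A′} {B′ = B′} {M} a b m) =
    trans (≡ᴰ-cong₂ (λ x y → cabs s₁ s₂ x y M) abs₁ abs₂ (⇒⊆≡ᴰ a) (⇒⊆≡ᴰ b))
          (≡ᴰ-cong (cabs s₁ s₂ A′ B′) abs₃ (⇒⊆≡ᴰ m))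
  ⇒⊆≡ᴰ (pAppc {s₁ = s₁} {s₂} {A} {A′} {B} {B′} {M} {M′} {N} {N′} a b m n) =
    trans (≡ᴰ-cong₂ (λ x y → capp s₁ s₂ x y M N) app₁ app₂ (⇒⊆≡ᴰ a) (⇒⊆≡ᴰ b))
          (≡ᴰ-cong₂ (capp s₁ s₂ A′ B′) app₃ app₄ (⇒⊆≡ᴰ m) (⇒⊆≡ᴰ n))
  ⇒⊆≡ᴰ (pβ {A = A} m n) =
    trans (≡ᴰ-cong₂ (λ x y → App (Lam A x) y) (App₁ ∘ Lam₂) App₂ (⇒⊆≡ᴰ m) (⇒⊆≡ᴰ n))
          (step (root β))
  ⇒⊆≡ᴰ (pEl-u a) = step (root (El-u a))
  ⇒⊆≡ᴰ (pApp-abs {s₁ = s₁} {s₂} {A = A} {B} {A′} {B′} r m n) =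
    trans (≡ᴰ-cong₂ (λ x y → capp s₁ s₂ A B (cabs s₁ s₂ A′ B′ x) y)
                    (app₃ ∘ abs₃) app₄ (⇒⊆≡ᴰ m) (⇒⊆≡ᴰ n))
          (step (root (app-abs r)))

  ⇒*⊆≡ᴰ : ∀ {n} {M M′ : DTm n} → M ⇒* M′ → M ≡ᴰ M′
  ⇒*⊆≡ᴰ = fold _≡ᴰ_ (λ p e → trans (⇒⊆≡ᴰ p) e) refl

  ≡ᴰ⇒joinable : ∀ {n} {M M′ : DTm n} → M ≡ᴰ M′ → ∃ λ Z → M ⇒* Z × M′ ⇒* Z
  ≡ᴰ⇒joinable (step c) = _ , Comp⊆⇒ c ◅ ε , ε
  ≡ᴰ⇒joinable refl = _ , ε , ε
  ≡ᴰ⇒joinable (sym e) with ≡ᴰ⇒joinable e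
  ... | _ , p , q = _ , q , p
  ≡ᴰ⇒joinable (trans e e′) with ≡ᴰ⇒joinable e | ≡ᴰ⇒joinable e′
  ... | _ , p , q | _ , p′ , q′ with ⇒-confluent q p′
  ...   | _ , r , r′ = _ , p ◅◅ r , q′ ◅◅ r′

  Pi-⇒* : ∀ {n} {A : DTm n} {B X} → Pi A B ⇒* X →
          ∃₂ λ A′ B′ → X ≡ Pi A′ B′ × A ⇒* A′ × B ⇒* B′
  Pi-⇒* ε = _ , _ , refl , ε , ε
  Pi-⇒* (pPi a b ◅ r) with Pi-⇒* r
  ... | _ , _ , refl , as , bs = _ , _ , refl , a ◅ as , b ◅ bs

  Pi-injective : ∀ {n} {A A′ : DTm n} {B B′} → Pi A B ≡ᴰ Pi A′ B′ → A ≡ᴰ A′ × B ≡ᴰ B′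
  Pi-injective e with ≡ᴰ⇒joinable e
  ... | _ , p , p′ with Pi-⇒* p | Pi-⇒* p′
  ...   | _ , _ , refl , as , bs | _ , _ , refl , as′ , bs′ =
    trans (⇒*⊆≡ᴰ as) (sym (⇒*⊆≡ᴰ as′)) , trans (⇒*⊆≡ᴰ bs) (sym (⇒*⊆≡ᴰ bs′))

  data NonPi {n} : DTm n → Set where
    isEl   : ∀ {s A} → NonPi (cEl s A)
    isU    : ∀ {s} → NonPi (cU s)
    isTYPE : NonPi TYPE
    isKIND : NonPi KIND

  NonPi-⌜⌝ : ∀ {n} s → NonPi {n} ⌜ s ⌝
  NonPi-⌜⌝ type = isTYPE
  NonPi-⌜⌝ kind = isKIND

  NonPi-dren : ∀ {m n} (ρ : ERen m n) {X} → NonPi X → NonPi (dren ρ X)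
  NonPi-dren ρ isEl = isEl
  NonPi-dren ρ isU = isU
  NonPi-dren ρ isTYPE = isTYPE
  NonPi-dren ρ isKIND = isKIND

  NonPi-⇒ : ∀ {n} {X X′ : DTm n} → X ⇒ X′ → NonPi X → NonPi X′
  NonPi-⇒ (pEl _) isEl = isEl
  NonPi-⇒ (pEl-u _) isEl = isU
  NonPi-⇒ pU isU = isU
  NonPi-⇒ pType isTYPE = isTYPE
  NonPi-⇒ pKind isKIND = isKIND

  NonPi-⇒* : ∀ {n} {X X′ : DTm n} → X ⇒* X′ → NonPi X → NonPi X′
  NonPi-⇒* = fold (λ X X′ → NonPi X → NonPi X′) (λ p k → k ∘ NonPi-⇒ p) id

  NonPi≢Pi : ∀ {n} {X A : DTm n} {B} → NonPi X → ¬ X ≡ᴰ Pi A B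
  NonPi≢Pi nonPi e with ≡ᴰ⇒joinable e
  ... | _ , p , q with Pi-⇒* q
  ...   | _ , _ , refl , _ , _ with NonPi-⇒* p nonPi
  ...     | ()

  -- Typing

  ⊢ᴰ-wf : ∀ {n} {Γ : DCtx n} {M T} → Γ ⊢ᴰ M ∶ T → ⊢ᴰ Γ
  ⊢ᴰ-wf (var w i) = w
  ⊢ᴰ-wf (sort w) = w
  ⊢ᴰ-wf (pi a b) = ⊢ᴰ-wf a
  ⊢ᴰ-wf (lam a b m) = ⊢ᴰ-wf a
  ⊢ᴰ-wf (app m n) = ⊢ᴰ-wf m
  ⊢ᴰ-wf (conv m _ _) = ⊢ᴰ-wf m
  ⊢ᴰ-wf (U w) = w
  ⊢ᴰ-wf (El a) = ⊢ᴰ-wf a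
  ⊢ᴰ-wf (u _ w) = w
  ⊢ᴰ-wf (Prod _ a _) = ⊢ᴰ-wf a
  ⊢ᴰ-wf (abs _ a _ _) = ⊢ᴰ-wf a
  ⊢ᴰ-wf (appc _ a _ _ _) = ⊢ᴰ-wf a

  retype : ∀ {n} {Γ : DCtx n} {M T T′} → T ≡ T′ → Γ ⊢ᴰ M ∶ T → Γ ⊢ᴰ M ∶ T′
  retype {Γ = Γ} {M} = subst (Γ ⊢ᴰ M ∶_)

  dren-⌜⌝ : ∀ {m n} (ρ : ERen m n) s → dren ρ ⌜ s ⌝ ≡ ⌜ s ⌝
  dren-⌜⌝ ρ type = refl
  dren-⌜⌝ ρ kind = refl

  _⊢ʳ_∶_ : ∀ {m n} → DCtx n → ERen m n → DCtx m → Set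
  Δ ⊢ʳ ρ ∶ Γ = ∀ i → dlookup Δ (ρ i) ≡ dren ρ (dlookup Γ i)

  ⊢ʳ-liftR : ∀ {m n} {Γ : DCtx m} {Δ : DCtx n} {ρ} (A : DTm m) →
             Δ ⊢ʳ ρ ∶ Γ → (Δ ▸ dren ρ A) ⊢ʳ liftR ρ ∶ (Γ ▸ A)
  ⊢ʳ-liftR {ρ = ρ} A ρ-ok zero = ≡.sym (dren-liftR-suc ρ A)
  ⊢ʳ-liftR {Γ = Γ} {ρ = ρ} A ρ-ok (suc i) =
    ≡.trans (cong (dren suc) (ρ-ok i)) (≡.sym (dren-liftR-suc ρ (dlookup Γ i)))

  ⊢ᴰ-dren : ∀ {m n} {Γ : DCtx m} {Δ : DCtx n} {ρ} → Δ ⊢ʳ ρ ∶ Γ → ⊢ᴰ Δ →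
            ∀ {M T} → Γ ⊢ᴰ M ∶ T → Δ ⊢ᴰ dren ρ M ∶ dren ρ T
  ⊢ᴰ-dren {ρ = ρ} ρ-ok w (var _ i) = retype (ρ-ok i) (var w (ρ i))
  ⊢ᴰ-dren ρ-ok w (sort _) = sort w
  ⊢ᴰ-dren {ρ = ρ} ρ-ok w (pi {A = A} {s = s} a b) =
    retype (≡.sym (dren-⌜⌝ ρ s))
      (pi a′ (retype (dren-⌜⌝ (liftR ρ) s)
                (⊢ᴰ-dren (⊢ʳ-liftR A ρ-ok) (_▸_ {s = type} w a′) b)))
    where a′ = ⊢ᴰ-dren ρ-ok w a
  ⊢ᴰ-dren {ρ = ρ} ρ-ok w (lam {A = A} {s = s} a b m) =
    lam a′ (retype (dren-⌜⌝ (liftR ρ) s) (⊢ᴰ-dren (⊢ʳ-liftR A ρ-ok) w′ b))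
           (⊢ᴰ-dren (⊢ʳ-liftR A ρ-ok) w′ m)
    where
    a′ = ⊢ᴰ-dren ρ-ok w a
    w′ = _▸_ {s = type} w a′
  ⊢ᴰ-dren {ρ = ρ} ρ-ok w (app {B = B} {N = N} m n) =
    retype (≡.sym (dren-[] ρ B N)) (app (⊢ᴰ-dren ρ-ok w m) (⊢ᴰ-dren ρ-ok w n))
  ⊢ᴰ-dren {ρ = ρ} ρ-ok w (conv {s = s} m b e) =
    conv (⊢ᴰ-dren ρ-ok w m) (retype (dren-⌜⌝ ρ s) (⊢ᴰ-dren ρ-ok w b)) (≡ᴰ-dren ρ e)
  ⊢ᴰ-dren ρ-ok w (U _) = U w
  ⊢ᴰ-dren ρ-ok w (El a) = El (⊢ᴰ-dren ρ-ok w a)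
  ⊢ᴰ-dren ρ-ok w (u ax _) = u ax w
  ⊢ᴰ-dren ρ-ok w (Prod r a b) = Prod r (⊢ᴰ-dren ρ-ok w a) (⊢ᴰ-dren ρ-ok w b)
  ⊢ᴰ-dren {ρ = ρ} ρ-ok w (abs {s₁ = s₁} {s₂} {A = A} {B} r a b m) =
    abs r (⊢ᴰ-dren ρ-ok w a) (⊢ᴰ-dren ρ-ok w b)
      (retype (cong (λ X → Pi (cEl s₁ (dren ρ A)) (cEl s₂ (App X (var zero))))
                               (dren-liftR-suc ρ B))
             (⊢ᴰ-dren ρ-ok w m))
  ⊢ᴰ-dren ρ-ok w (appc r a b m n) =
    appc r (⊢ᴰ-dren ρ-ok w a) (⊢ᴰ-dren ρ-ok w b) (⊢ᴰ-dren ρ-ok w m) (⊢ᴰ-dren ρ-ok w n)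

  ⊢ᴰ-weaken : ∀ {n} {Γ : DCtx n} {A} → ⊢ᴰ (Γ ▸ A) →
              ∀ {M T} → Γ ⊢ᴰ M ∶ T → (Γ ▸ A) ⊢ᴰ dren suc M ∶ dren suc T
  ⊢ᴰ-weaken = ⊢ᴰ-dren (λ _ → refl)

  _≼_ : ∀ {n} → DCtx n → DCtx n → Set
  _≼_ {n} Γ Δ = ∀ (i : Fin n) → Δ ⊢ᴰ var i ∶ dlookup Γ i

  ≼-▸ : ∀ {n} {Γ Δ : DCtx n} {A s} → Γ ≼ Δ → ⊢ᴰ Δ → Δ ⊢ᴰ A ∶ ⌜ s ⌝ → (Γ ▸ A) ≼ (Δ ▸ A)
  ≼-▸ Γ≼Δ w a zero = var (w ▸ a) zero
  ≼-▸ Γ≼Δ w a (suc i) = ⊢ᴰ-weaken (w ▸ a) (Γ≼Δ i)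

  ⊢ᴰ-≼ : ∀ {n} {Γ Δ : DCtx n} → Γ ≼ Δ → ⊢ᴰ Δ → ∀ {M T} → Γ ⊢ᴰ M ∶ T → Δ ⊢ᴰ M ∶ T
  ⊢ᴰ-≼ Γ≼Δ w (var _ i) = Γ≼Δ i
  ⊢ᴰ-≼ Γ≼Δ w (sort _) = sort w
  ⊢ᴰ-≼ Γ≼Δ w (pi a b) = pi a′ (⊢ᴰ-≼ (≼-▸ Γ≼Δ w a′) (_▸_ {s = type} w a′) b)
    where a′ = ⊢ᴰ-≼ Γ≼Δ w a
  ⊢ᴰ-≼ Γ≼Δ w (lam a b m) = lam a′ (⊢ᴰ-≼ (≼-▸ Γ≼Δ w a′) w′ b) (⊢ᴰ-≼ (≼-▸ Γ≼Δ w a′) w′ m)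
    where
    a′ = ⊢ᴰ-≼ Γ≼Δ w a
    w′ = _▸_ {s = type} w a′
  ⊢ᴰ-≼ Γ≼Δ w (app m n) = app (⊢ᴰ-≼ Γ≼Δ w m) (⊢ᴰ-≼ Γ≼Δ w n)
  ⊢ᴰ-≼ Γ≼Δ w (conv m b e) = conv (⊢ᴰ-≼ Γ≼Δ w m) (⊢ᴰ-≼ Γ≼Δ w b) e
  ⊢ᴰ-≼ Γ≼Δ w (U _) = U w
  ⊢ᴰ-≼ Γ≼Δ w (El a) = El (⊢ᴰ-≼ Γ≼Δ w a)
  ⊢ᴰ-≼ Γ≼Δ w (u ax _) = u ax w
  ⊢ᴰ-≼ Γ≼Δ w (Prod r a b) = Prod r (⊢ᴰ-≼ Γ≼Δ w a) (⊢ᴰ-≼ Γ≼Δ w b)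
  ⊢ᴰ-≼ Γ≼Δ w (abs r a b m) = abs r (⊢ᴰ-≼ Γ≼Δ w a) (⊢ᴰ-≼ Γ≼Δ w b) (⊢ᴰ-≼ Γ≼Δ w m)
  ⊢ᴰ-≼ Γ≼Δ w (appc r a b m n) =
    appc r (⊢ᴰ-≼ Γ≼Δ w a) (⊢ᴰ-≼ Γ≼Δ w b) (⊢ᴰ-≼ Γ≼Δ w m) (⊢ᴰ-≼ Γ≼Δ w n)

  ⊢ᴰ-conv-head : ∀ {n} {Γ : DCtx n} {A A′ M T} → Γ ⊢ᴰ A′ ∶ TYPE → Γ ⊢ᴰ A ∶ TYPE → A′ ≡ᴰ A →
                 (Γ ▸ A′) ⊢ᴰ M ∶ T → (Γ ▸ A) ⊢ᴰ M ∶ T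
  ⊢ᴰ-conv-head {Γ = Γ} {A} {A′} a′ a A′≡A = ⊢ᴰ-≼ head w
    where
    w : ⊢ᴰ (Γ ▸ A)
    w = _▸_ {s = type} (⊢ᴰ-wf a) a
    head : (Γ ▸ A′) ≼ (Γ ▸ A)
    head zero = conv (var w zero) (⊢ᴰ-weaken w a′) (≡ᴰ-dren suc (sym A′≡A))
    head (suc i) = var w (suc i)

  Pi-inversion : ∀ {n} {Γ : DCtx n} {A B T} → Γ ⊢ᴰ Pi A B ∶ T →
                 Γ ⊢ᴰ A ∶ TYPE × ∃ λ s → (Γ ▸ A) ⊢ᴰ B ∶ ⌜ s ⌝
  Pi-inversion (pi a b) = a , _ , b
  Pi-inversion (conv d _ _) = Pi-inversion d

  Lam-generation : ∀ {n} {Γ : DCtx n} {A′ N T} → Γ ⊢ᴰ Lam A′ N ∶ T →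
                   ∃ λ B′ → Γ ⊢ᴰ A′ ∶ TYPE × (Γ ▸ A′) ⊢ᴰ N ∶ B′ × Pi A′ B′ ≡ᴰ T
  Lam-generation (lam a b m) = _ , a , m , refl
  Lam-generation (conv d _ e) with Lam-generation d
  ... | B′ , a , m , e′ = B′ , a , m , trans e′ e

  Lam-type-wellformed : ∀ {n} {Γ : DCtx n} {A′ N T} → Γ ⊢ᴰ Lam A′ N ∶ T → ∃ λ s → Γ ⊢ᴰ T ∶ ⌜ s ⌝
  Lam-type-wellformed (lam a b m) = _ , pi a b
  Lam-type-wellformed (conv d t e) = _ , t

  Lam-inversion : ∀ {n} {Γ : DCtx n} {A′ N A B} → Γ ⊢ᴰ Lam A′ N ∶ Pi A B →
                  A′ ≡ᴰ A × (Γ ▸ A) ⊢ᴰ N ∶ B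
  Lam-inversion ⊢λ =
    let (_ , ⊢A′ , ⊢N , ΠA′B′≡ΠAB) = Lam-generation ⊢λ
        (A′≡A , B′≡B) = Pi-injective ΠA′B′≡ΠAB
        (_ , ⊢ΠAB) = Lam-type-wellformed ⊢λ
        (⊢A , _ , ⊢B) = Pi-inversion ⊢ΠAB
    in A′≡A , conv (⊢ᴰ-conv-head ⊢A′ ⊢A A′≡A ⊢N) ⊢B B′≡B

  βNormal-inhabitant-of-Pi-is-Lam :
    ∀ {n} {Γ : DCtx n} → (∀ i → NonPi (dlookup Γ i)) →
    ∀ {M T A B} → Γ ⊢ᴰ M ∶ T → βNormal M → T ≡ᴰ Pi A B → ∃₂ λ A′ N → M ≡ Lam A′ N
  βNormal-inhabitant-of-Pi-is-Lam vars (var _ i) nf e = ⊥-elim (NonPi≢Pi (vars i) e)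
  βNormal-inhabitant-of-Pi-is-Lam vars (sort _) nf e = ⊥-elim (NonPi≢Pi isKIND e)
  βNormal-inhabitant-of-Pi-is-Lam vars (pi {s = s} _ _) nf e = ⊥-elim (NonPi≢Pi (NonPi-⌜⌝ s) e)
  βNormal-inhabitant-of-Pi-is-Lam vars (lam _ _ _) nf e = _ , _ , refl
  βNormal-inhabitant-of-Pi-is-Lam vars (app m _) nf e
    with βNormal-inhabitant-of-Pi-is-Lam vars m (λ _ c → nf _ (App₁ c)) refl
  ... | _ , _ , refl = ⊥-elim (nf _ (root β))
  βNormal-inhabitant-of-Pi-is-Lam vars (conv m _ e′) nf e =
    βNormal-inhabitant-of-Pi-is-Lam vars m nf (trans e′ e)
  βNormal-inhabitant-of-Pi-is-Lam vars (U _) nf e = ⊥-elim (NonPi≢Pi isTYPE e)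
  βNormal-inhabitant-of-Pi-is-Lam vars (El _) nf e = ⊥-elim (NonPi≢Pi isTYPE e)
  βNormal-inhabitant-of-Pi-is-Lam vars (u _ _) nf e = ⊥-elim (NonPi≢Pi isU e)
  βNormal-inhabitant-of-Pi-is-Lam vars (Prod _ _ _) nf e = ⊥-elim (NonPi≢Pi isU e)
  βNormal-inhabitant-of-Pi-is-Lam vars (abs _ _ _ _) nf e = ⊥-elim (NonPi≢Pi isEl e)
  βNormal-inhabitant-of-Pi-is-Lam vars (appc _ _ _ _ _) nf e = ⊥-elim (NonPi≢Pi isEl e)

  ⟦⟧ᶜ-NonPi : ∀ {n} {Γ : ECtx n} (wf : ⊢ᴱ Γ) → ∀ i → NonPi (dlookup ⟦ wf ⟧ᶜ i)
  ⟦⟧ᶜ-NonPi (wf ▸ _) zero = isEl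
  ⟦⟧ᶜ-NonPi (wf ▸ _) (suc i) = NonPi-dren suc (⟦⟧ᶜ-NonPi wf i)

mainTheorem15 : (S : Spec) → let open Theory S in
    ∀ {n} {Γ : ECtx n} (wf : ⊢ᴱ Γ) (M A : DTm n) (B : DTm (suc n)) →
      βNormal M →
      ⟦ wf ⟧ᶜ ⊢ᴰ M ∶ Pi A B →
      Σ (DTm n) λ A′ → Σ (DTm (suc n)) λ N →
        (M ≡ Lam A′ N) × (A′ ≡ᴰ A) × ((⟦ wf ⟧ᶜ ▸ A) ⊢ᴰ N ∶ B)
mainTheorem15 S wf M A B nf ⊢M =
  let open Theory S
      open Metatheory S
      (A′ , N , M≡λ) = βNormal-inhabitant-of-Pi-is-Lam (⟦⟧ᶜ-NonPi wf) ⊢M nf refl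
      (A′≡A , ⊢N) = Lam-inversion (subst (λ X → ⟦ wf ⟧ᶜ ⊢ᴰ X ∶ Pi A B) M≡λ ⊢M)
  in A′ , N , M≡λ , A′≡A , ⊢N
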